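{- Let $m\geq 4$ be an integer and let $G$ be a finite $m$-free digraph. Then $\beta(G)\leq \frac{1}{m-2}\gamma(G)$.
   Context: All digraphs are finite, without loops and without parallel edges. A digraph is $m$-free if it contains no directed cycle of length at most $m$; it is acyclic if it contains no directed cycle. For a digraph $G$, $\beta(G)$ denotes the minimum size of a set $X\subseteq E(G)$ of edges such that $G-X$ is acyclic, and $\gamma(G)$ denotes the number of unordered pairs $\{u,w\}$ of distinct vertices of $G$ that are nonadjacent, i.e. neither $(u,w)$ nor $(w,u)$ is an edge of $G$. -}

module Defs where

open import Data.Nat using (ℕ; zero; suc; _+_; _≤_; _<_; _<?_)
open import Relation.Nullary.Decidable using (isYes)
open import Data.Bool using (Bool; true; false; T; _∧_; not)
open import Data.Fin using (Fin; zero; suc; toℕ; inject₁; fromℕ)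
open import Data.Product using (Σ; ∃; _×_)
open import Data.Empty using (⊥)
open import Relation.Nullary using (¬_)
open import Relation.Binary.PropositionalEquality using (_≡_)
open import Function.Definitions using (Injective)

-- A finite digraph on the vertex set Fin n: an edge relation given as a
-- Boolean adjacency matrix, with no loops.  (No parallel edges is automatic:
-- an ordered pair is either an edge or not.)
record Digraph (n : ℕ) : Set where
  field
    edge   : Fin n → Fin n → Bool
    noLoop : ∀ v → edge v v ≡ false
open Digraph public

count : {n : ℕ} → (Fin n → Bool) → ℕ
count {zero}  f = 0
count {suc n} f = (if f zero then 1 else 0) + count (λ i → f (suc i))
  where open import Data.Bool using (if_then_else_)

-- A directed cycle of length (suc k) in the edge relation E:
-- distinct vertices v 0, …, v k with edges v i → v (i+1) and v k → v 0.
record DirCycle {n : ℕ} (E : Fin n → Fin n → Bool) (k : ℕ) : Set where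
  field
    vert     : Fin (suc k) → Fin n
    distinct : Injective _≡_ _≡_ vert
    step     : ∀ (i : Fin k) → T (E (vert (inject₁ i)) (vert (suc i)))
    close    : T (E (vert (fromℕ k)) (vert zero))

MFree : {n : ℕ} → ℕ → Digraph n → Set
MFree m G = ∀ k → suc k ≤ m → ¬ DirCycle (edge G) k

Acyclic : {n : ℕ} → (Fin n → Fin n → Bool) → Set
Acyclic E = ∀ k → ¬ DirCycle E k

sumFin : {n : ℕ} → (Fin n → ℕ) → ℕ
sumFin {zero}  f = 0
sumFin {suc n} f = f zero + sumFin (λ i → f (suc i))

size : {n : ℕ} → (Fin n → Fin n → Bool) → ℕ
size X = sumFin (λ u → count (X u))

removeEdges : {n : ℕ} → (Fin n → Fin n → Bool) → (Fin n → Fin n → Bool) → (Fin n → Fin n → Bool)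
removeEdges E X u w = E u w ∧ not (X u w)

-- β(G) ≤ b : some feedback edge set X ⊆ E(G) with G − X acyclic has |X| ≤ b.
-- (β(G) is the minimum of |X| over such X; feedback sets always exist.)
IsFeedbackSet : {n : ℕ} → (G : Digraph n) → (Fin n → Fin n → Bool) → Set
IsFeedbackSet G X = (∀ u w → T (X u w) → T (edge G u w)) × Acyclic (removeEdges (edge G) X)

nonadj : {n : ℕ} → Digraph n → Fin n → Fin n → Bool
nonadj G u w = not (edge G u w) ∧ not (edge G w u)

-- γ(G): number of unordered pairs {u , w}, u ≠ w, that are nonadjacent;
-- counted as ordered pairs with toℕ u < toℕ w.
γ : {n : ℕ} → Digraph n → ℕ
γ G = sumFin (λ u → count (λ w → (isYes (toℕ u <? toℕ w)) ∧ nonadj G u w))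

{-# OPTIONS --safe #-}

-- Fix a nonempty vertex set and a vertex b, and let X be the set of vertices at distance
-- 1, …, i from b (1 ≤ i ≤ m − 2) and Y the other vertices apart from b.  In the order Y, b, X
-- only edges from X to Y go backward, so by induction on the vertex set it suffices to find
-- b and i such that (m − 2) e(X, Y) is at most the number of nonadjacent pairs between X and Y.
--
-- Let S i be the number of triples (a, x, y) with an edge x → y from distance i to distance
-- i + 1 from a, and S′ i the same number in the reversed digraph.  The backward edges for b, i
-- run from distance i to distance i + 1 from b, so they sum to at most S i over all b.
-- On the other hand a pair (x, y) with d(y, x) = d(y, b) + d(b, x) is nonadjacent because
-- there are no short cycles.  The pairs with d(b, x) = 1 and d(y, b) = j, for j ≤ m − 1 − i, and
-- those with d(b, x) = s and d(y, b) = 1, for 2 ≤ s ≤ i, are distinct, lie across X and Y, and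
-- sum over b to at least S 1 + … + S (m − 1 − i) and S′ 2 + … + S′ i respectively: m − 2 terms
-- in total.  Hence an i minimising S (or S′, after reversing the digraph) admits a suitable b.
module Submission where

open import Defs
open import Data.Nat using (ℕ; zero; suc; _+_; _≤_; _<_; _*_; _∸_; _≤?_; _<?_; z≤n; s≤s; z<s; s<s; s≤s⁻¹)
open import Data.Nat.Properties as ℕ
  using (≤-refl; ≤-reflexive; ≤-trans; ≤-<-trans; <-≤-trans; <⇒≤; ≮⇒≥; ≰⇒>; <⇒≱; n≮n; <-cmp;
         +-mono-≤; +-mono-<-≤; +-mono-≤-<; *-monoʳ-≤; anyUpTo?; allUpTo?; module ≤-Reasoning)
open import Data.Nat.Induction using (<-rec; <-wellFounded; Acc; acc)
open import Data.Nat.Tactic.RingSolver using (solve-∀)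
open import Data.Fin using (Fin; zero; suc; toℕ; inject₁; fromℕ; fromℕ<)
open import Data.Fin.Properties using (_≟_; any?; toℕ<n; toℕ-injective; toℕ-inject₁; toℕ-fromℕ;
  toℕ-fromℕ<; suc-injective; 0≢1+n)
open import Data.Bool using (Bool; true; false; T; _∧_; not)
open import Data.Bool.Properties using (T-∧)
open import Data.Empty using (⊥)
open import Data.Product using (Σ; ∃; _×_; _,_; proj₁; proj₂; swap)
open import Data.Sum as Sum using (_⊎_; inj₁; inj₂)
open import Data.Unit using (⊤; tt)
import Algebra.Properties.Semiring.Sum ℕ.+-*-semiring as Summation
open import Function using (flip; _∘_; Equivalence)
open import Function.Definitions using (Injective)
open import Relation.Binary using (tri<; tri≈; tri>) renaming (Decidable to Decidable₂)
open import Relation.Binary.PropositionalEquality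
  using (_≡_; _≢_; refl; sym; trans; cong; cong₂; subst; subst₂)
open import Relation.Nullary using (Dec; yes; no; ¬_; contradiction)
open import Relation.Nullary.Decidable using (_×-dec_; _⊎-dec_; ¬?; T?; isYes; toWitness; fromWitness)
open import Relation.Unary using () renaming (Decidable to Decidable₁)

private variable
  A B C D : Set
  n : ℕ

-- Finite sums and indicators

-- Sums and indicators are opaque so that summands can be inferred by unification.
opaque
  ∑ : (Fin n → ℕ) → ℕ
  ∑ = Summation.sum

  ∑-cong : {f g : Fin n → ℕ} → (∀ i → f i ≡ g i) → ∑ f ≡ ∑ g
  ∑-cong = Summation.sum-cong-≗

  ∑-comm : ∀ {k} (f : Fin k → Fin n → ℕ) → ∑ (λ i → ∑ (f i)) ≡ ∑ λ j → ∑ λ i → f i j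
  ∑-comm = Summation.∑-comm

  ∑-+ : (f g : Fin n → ℕ) → ∑ (λ i → f i + g i) ≡ ∑ f + ∑ g
  ∑-+ = Summation.∑-distrib-+

  ∑-* : ∀ c (f : Fin n → ℕ) → c * ∑ f ≡ ∑ λ i → c * f i
  ∑-* = Summation.*-distribˡ-sum

  sumFin≡∑ : (f : Fin n → ℕ) → sumFin f ≡ ∑ f
  sumFin≡∑ {zero}  f = refl
  sumFin≡∑ {suc n} f = cong (f zero +_) (sumFin≡∑ (f ∘ suc))

  ∑-mono : {f g : Fin n → ℕ} → (∀ i → f i ≤ g i) → ∑ f ≤ ∑ g
  ∑-mono {zero}  f≤g = z≤n
  ∑-mono {suc n} f≤g = +-mono-≤ (f≤g zero) (∑-mono (f≤g ∘ suc))

  ∑-mono-< : {f g : Fin n → ℕ} → (∀ i → f i ≤ g i) → ∀ j → f j < g j → ∑ f < ∑ g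
  ∑-mono-< f≤g zero    lt = +-mono-<-≤ lt (∑-mono (f≤g ∘ suc))
  ∑-mono-< f≤g (suc j) lt = +-mono-≤-< (f≤g zero) (∑-mono-< (f≤g ∘ suc) j lt)

  ∑-zero : {f : Fin n → ℕ} → (∀ i → f i ≡ 0) → ∑ f ≡ 0
  ∑-zero {zero}  f≡0 = refl
  ∑-zero {suc n} f≡0 = cong₂ _+_ (f≡0 zero) (∑-zero (f≡0 ∘ suc))

  *≤∑ : ∀ {c} {f : Fin n → ℕ} → (∀ i → c ≤ f i) → n * c ≤ ∑ f
  *≤∑ {zero}  c≤f = z≤n
  *≤∑ {suc n} c≤f = +-mono-≤ (c≤f zero) (*≤∑ (c≤f ∘ suc))

-- Otherwise `g` is below `f` everywhere: strictly on `P`, and weakly off `P` because `g` vanishes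
-- there. The witness of `P` then makes the comparison of the sums strict.
∑-averaging : {P : Fin n → Set} (P? : Decidable₁ P) {f g : Fin n → ℕ} →
  ∃ P → (∀ i → ¬ P i → g i ≡ 0) → ∑ f ≤ ∑ g → ∃ λ i → P i × f i ≤ g i
∑-averaging P? {f} {g} (j , Pj) g≡0 ∑f≤∑g with any? (λ i → P? i ×-dec f i ≤? g i)
... | yes found = found
... | no ¬found = contradiction ∑f≤∑g (<⇒≱ (∑-mono-< g≤f j (g<f j Pj)))
  where
  g<f : ∀ i → _ → g i < f i
  g<f i Pi = ≰⇒> λ f≤g → ¬found (i , Pi , f≤g)
  g≤f : ∀ i → g i ≤ f i
  g≤f i with P? i
  ... | yes Pi = <⇒≤ (g<f i Pi)
  ... | no ¬Pi = subst (_≤ f i) (sym (g≡0 i ¬Pi)) z≤n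

∑₂ : (Fin n → Fin n → ℕ) → ℕ
∑₂ f = ∑ λ u → ∑ (f u)

∑₂-mono : {f g : Fin n → Fin n → ℕ} → (∀ u w → f u w ≤ g u w) → ∑₂ f ≤ ∑₂ g
∑₂-mono f≤g = ∑-mono λ u → ∑-mono (f≤g u)

∑₂-+ : (f g : Fin n → Fin n → ℕ) → ∑₂ (λ u w → f u w + g u w) ≡ ∑₂ f + ∑₂ g
∑₂-+ f g = trans (∑-cong λ u → ∑-+ (f u) (g u)) (∑-+ _ _)

∑₂-zero : {f : Fin n → Fin n → ℕ} → (∀ u w → f u w ≡ 0) → ∑₂ f ≡ 0
∑₂-zero f≡0 = ∑-zero λ u → ∑-zero (f≡0 u)

∑₃ : (Fin n → Fin n → Fin n → ℕ) → ℕ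
∑₃ f = ∑ λ a → ∑₂ (f a)

∑₃-mono : {f g : Fin n → Fin n → Fin n → ℕ} → (∀ a b c → f a b c ≤ g a b c) → ∑₃ f ≤ ∑₃ g
∑₃-mono f≤g = ∑-mono λ a → ∑₂-mono (f≤g a)

∑₃-+ : (f g : Fin n → Fin n → Fin n → ℕ) → ∑₃ (λ a b c → f a b c + g a b c) ≡ ∑₃ f + ∑₃ g
∑₃-+ f g = trans (∑-cong λ a → ∑₂-+ (f a) (g a)) (∑-+ _ _)

∑₃-swap : (f : Fin n → Fin n → Fin n → ℕ) → ∑₃ f ≡ ∑₃ (λ b a c → f a b c)
∑₃-swap f = ∑-comm λ a b → ∑ (f a b)

∑₃-rotate : (f : Fin n → Fin n → Fin n → ℕ) → ∑₃ f ≡ ∑₃ (λ b c a → f a b c)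
∑₃-rotate f = trans (∑₃-swap f) (∑-cong λ b → ∑-comm λ a c → f a b c)

∑-∑₃-comm : ∀ {k} (f : Fin k → Fin n → Fin n → Fin n → ℕ) →
  ∑ (λ t → ∑₃ (f t)) ≡ ∑₃ λ a b c → ∑ λ t → f t a b c
∑-∑₃-comm f =
  trans (∑-comm _) (∑-cong λ a → trans (∑-comm _) (∑-cong λ b → ∑-comm _))

opaque
  unfolding ∑

  #_ : Dec A → ℕ
  # yes _ = 1
  # no  _ = 0

  #-mono : {A? : Dec A} {B? : Dec B} → (A → B) → # A? ≤ # B?
  #-mono {A? = yes a} {B? = yes b} f = ≤-refl
  #-mono {A? = yes a} {B? = no ¬b} f = contradiction (f a) ¬b
  #-mono {A? = no ¬a} f = z≤n

  #-zero : {A? : Dec A} → ¬ A → # A? ≡ 0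
  #-zero {A? = yes a} ¬a = contradiction a ¬a
  #-zero {A? = no _}  ¬a = refl

  #-< : {A? : Dec A} {B? : Dec B} → ¬ A → B → # A? < # B?
  #-< {A? = yes a} ¬a b = contradiction a ¬a
  #-< {A? = no _} {B? = yes _} ¬a b = ≤-refl
  #-< {A? = no _} {B? = no ¬b} ¬a b = contradiction b ¬b

  #-⊎ : {A? : Dec A} {B? : Dec B} {C? : Dec C} → (A → B ⊎ C) → # A? ≤ # B? + # C?
  #-⊎ {A? = no _} f = z≤n
  #-⊎ {A? = yes a} {B? = yes _} f = s≤s z≤n
  #-⊎ {A? = yes a} {B? = no _} {C? = yes _} f = ≤-refl
  #-⊎ {A? = yes a} {B? = no ¬b} {C? = no ¬c} f with f a
  ... | inj₁ b = contradiction b ¬b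
  ... | inj₂ c = contradiction c ¬c

  #-⊎₃ : {A? : Dec A} {B? : Dec B} {C? : Dec C} {D? : Dec D} →
    (A → B ⊎ C ⊎ D) → # A? ≤ # B? + # C? + # D?
  #-⊎₃ {A? = no _} f = z≤n
  #-⊎₃ {A? = yes a} {B? = yes _} f = s≤s z≤n
  #-⊎₃ {A? = yes a} {B? = no _} {C? = yes _} f = s≤s z≤n
  #-⊎₃ {A? = yes a} {B? = no _} {C? = no _} {D? = yes _} f = ≤-refl
  #-⊎₃ {A? = yes a} {B? = no ¬b} {C? = no ¬c} {D? = no ¬d} f with f a
  ... | inj₁ b = contradiction b ¬b
  ... | inj₂ (inj₁ c) = contradiction c ¬c
  ... | inj₂ (inj₂ d) = contradiction d ¬d

  #-disjoint : {A? : Dec A} {B? : Dec B} {C? : Dec C} →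
    (A → C) → (B → C) → (A → ¬ B) → # A? + # B? ≤ # C?
  #-disjoint {A? = no _} f g ¬ab = #-mono g
  #-disjoint {A? = yes a} {B? = yes b} f g ¬ab = contradiction b (¬ab a)
  #-disjoint {A? = yes a} {B? = no _} {C? = yes _} f g ¬ab = ≤-refl
  #-disjoint {A? = yes a} {B? = no _} {C? = no ¬c} f g ¬ab = contradiction (f a) ¬c

  #-unique : ∀ {k} {A : Fin k → Set} {A? : ∀ t → Dec (A t)} {B? : Dec B} →
    (∀ t → A t → B) → (∀ s t → A s → A t → s ≡ t) → ∑ (λ t → # A? t) ≤ # B?
  #-unique {k = zero} f uniq = z≤n
  #-unique {k = suc k} {A? = A?} {B?} f uniq with A? zero | B?
  ... | no _   | B?′   = #-unique {B? = B?′} (f ∘ suc) λ s t as at → suc-injective (uniq _ _ as at)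
  ... | yes a₀ | no ¬b = contradiction (f zero a₀) ¬b
  ... | yes a₀ | yes _ = ≤-reflexive (cong suc (∑-zero {f = λ t → # A? (suc t)} λ t →
                           #-zero λ at → 0≢1+n (uniq _ _ a₀ at)))

  count≡∑ : (f : Fin n → Bool) → count f ≡ ∑ λ i → # T? (f i)
  count≡∑ {zero}  f = refl
  count≡∑ {suc n} f with f zero
  ... | true  = cong suc (count≡∑ (f ∘ suc))
  ... | false = count≡∑ (f ∘ suc)

size≡∑₂ : (X : Fin n → Fin n → Bool) → size X ≡ ∑₂ λ u w → # T? (X u w)
size≡∑₂ X = trans (sumFin≡∑ _) (∑-cong λ u → count≡∑ (X u))

-- Walks and distances

Walk : (Fin n → Fin n → Set) → ℕ → Fin n → Fin n → Set
Walk E zero    u w = u ≡ w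
Walk E (suc k) u w = ∃ λ z → E u z × Walk E k z w

NoShortClosedWalk : ℕ → (Fin n → Fin n → Set) → Set
NoShortClosedWalk m E = ∀ {k u} → suc k ≤ m → ¬ Walk E (suc k) u u

Nonadjacent : (Fin n → Fin n → Set) → Fin n → Fin n → Set
Nonadjacent E u w = u ≢ w × ¬ E u w × ¬ E w u

-- Distance as a relation, so that unreachable pairs need no special value.
Dist : (Fin n → Fin n → Set) → ℕ → Fin n → Fin n → Set
Dist E k u w = Walk E k u w × (∀ {j} → j < k → ¬ Walk E j u w)

module _ {E : Fin n → Fin n → Set} where

  _++_ : ∀ {j k u v w} → Walk E j u v → Walk E k v w → Walk E (j + k) u w
  _++_ {zero}  refl         q = q
  _++_ {suc j} (z , e , p) q = z , e , p ++ q

  snoc : ∀ {k u v w} → Walk E k u v → E v w → Walk E (suc k) u w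
  snoc {zero}  refl        e = _ , e , refl
  snoc {suc k} (z , d , p) e = z , d , snoc p e

  Dist-unique : ∀ {j k u w} → Dist E j u w → Dist E k u w → j ≡ k
  Dist-unique {j} {k} (p , p-min) (q , q-min) with <-cmp j k
  ... | tri< j<k _ _ = contradiction p (q-min j<k)
  ... | tri≈ _ j≡k _ = j≡k
  ... | tri> _ _ k<j = contradiction q (p-min k<j)

  -- Indexing by ℕ turns segments of a walk into index shifts. Past the end the value stays at the
  -- last vertex.
  nodes : ∀ {k u w} → Walk E k u w → ℕ → Fin n
  nodes {zero}  {u} _           _       = u
  nodes {suc k} {u} _           zero    = u
  nodes {suc k}     (z , _ , p) (suc t) = nodes p t

  nodes-start : ∀ {k u w} (p : Walk E k u w) → nodes p 0 ≡ u
  nodes-start {zero}  p = refl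
  nodes-start {suc k} p = refl

  nodes-end : ∀ {k u w} (p : Walk E k u w) → nodes p k ≡ w
  nodes-end {zero}  p           = p
  nodes-end {suc k} (z , _ , p) = nodes-end p

  nodes-step : ∀ {k u w} (p : Walk E k u w) {t} → t < k → E (nodes p t) (nodes p (suc t))
  nodes-step {suc k} (z , e , p) {zero}  _   = subst (E _) (sym (nodes-start p)) e
  nodes-step {suc k} (z , e , p) {suc t} t<k = nodes-step p (s≤s⁻¹ t<k)

Walk-map : ∀ {E F : Fin n → Fin n → Set} → (∀ {u w} → E u w → F u w) →
  ∀ {k u w} → Walk E k u w → Walk F k u w
Walk-map f {zero}  p           = p
Walk-map f {suc k} (z , e , p) = z , f e , Walk-map f p

Walk-flip : ∀ {E : Fin n → Fin n → Set} {k u w} → Walk (flip E) k u w → Walk E k w u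
Walk-flip {k = zero}  refl        = refl
Walk-flip {k = suc k} (z , e , p) = snoc (Walk-flip p) e

Dist-flip : ∀ {E : Fin n → Fin n → Set} {k u w} → Dist (flip E) k u w → Dist E k w u
Dist-flip (p , p-min) = Walk-flip p , λ j<k q → p-min j<k (Walk-flip q)

module _ {E : Fin n → Fin n → Set} (E? : Decidable₂ E) where

  Walk? : ∀ k u w → Dec (Walk E k u w)
  Walk? zero    u w = u ≟ w
  Walk? (suc k) u w = any? λ z → E? u z ×-dec Walk? k z w

  Dist? : ∀ k u w → Dec (Dist E k u w)
  Dist? k u w = Walk? k u w ×-dec allUpTo? (λ j → ¬? (Walk? j u w)) k

  Nonadjacent? : ∀ u w → Dec (Nonadjacent E u w)
  Nonadjacent? u w = ¬? (u ≟ w) ×-dec ¬? (E? u w) ×-dec ¬? (E? w u)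

-- From short cycles to short closed walks

-- The distance arguments concatenate walks that may share vertices, so they need to exclude closed
-- walks and not only cycles with distinct vertices.
MFree⇒NoShortClosedWalk : ∀ {m} (G : Digraph n) → MFree m G →
  NoShortClosedWalk m (λ u w → T (edge G u w))
MFree⇒NoShortClosedWalk {m = m} G m-free {k} k<m p =
  noClosedSequence k k<m (nodes p) (nodes-step p) (trans (nodes-end p) (sym (nodes-start p)))
  where
  ClosedSequenceFree : ℕ → Set
  ClosedSequenceFree k = suc k ≤ m → (v : ℕ → Fin _) →
    (∀ {t} → t < suc k → T (edge G (v t) (v (suc t)))) → v (suc k) ≢ v 0

  -- A repeated vertex splits off a shorter closed sequence.
  noClosedSequence : ∀ k → ClosedSequenceFree k
  noClosedSequence = <-rec ClosedSequenceFree λ k rec k<m v step closed → go k rec k<m v step closed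
    where
    go : ∀ k → (∀ {d} → d < k → ClosedSequenceFree d) → ClosedSequenceFree k
    go k rec k<m v step closed
      with any? {n = suc k} (λ i → any? {n = suc k} (λ j →
             (toℕ i <? toℕ j) ×-dec (v (toℕ i) ≟ v (toℕ j))))
    ... | yes (i , j , i<j , vi≡vj) =
      rec d<k (≤-trans (s≤s (<⇒≤ d<k)) k<m) (λ t → v (toℕ i + t)) step′
        (trans (cong v i+sd≡j) (trans (sym vi≡vj) (cong v (sym (ℕ.+-identityʳ (toℕ i))))))
      where
      d : ℕ
      -- Lengths are stored as predecessors: the closed segment from `i` to `j` has length `suc d`.
      d = toℕ j ∸ suc (toℕ i)
      i+sd≡j : toℕ i + suc d ≡ toℕ j
      i+sd≡j = trans (ℕ.+-suc (toℕ i) d) (ℕ.m+[n∸m]≡n i<j)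
      j≤k : toℕ j ≤ k
      j≤k = s≤s⁻¹ (toℕ<n j)
      d<k : d < k
      d<k = ≤-trans (ℕ.m≤n+m (suc d) (toℕ i)) (≤-trans (≤-reflexive i+sd≡j) j≤k)
      step′ : ∀ {t} → t < suc d → T (edge G (v (toℕ i + t)) (v (toℕ i + suc t)))
      step′ {t} t<sd = subst (λ x → T (edge G (v (toℕ i + t)) (v x))) (sym (ℕ.+-suc (toℕ i) t))
        (step (<-≤-trans (ℕ.+-monoʳ-< (toℕ i) t<sd) (≤-trans (≤-reflexive i+sd≡j) (≤-trans j≤k (ℕ.n≤1+n k)))))
    ... | no ¬repeat = m-free k k<m record
      { vert     = v ∘ toℕ
      ; distinct = injective
      ; step     = λ i → subst (λ x → T (edge G (v x) (v (suc (toℕ i))))) (sym (toℕ-inject₁ i))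
                           (step (ℕ.m<n⇒m<1+n (toℕ<n i)))
      ; close    = subst₂ (λ x y → T (edge G (v x) y)) (sym (toℕ-fromℕ k)) closed (step ≤-refl)
      }
      where
      injective : Injective _≡_ _≡_ (v ∘ toℕ {suc k})
      injective {i} {j} vi≡vj with <-cmp (toℕ i) (toℕ j)
      ... | tri< i<j _ _ = contradiction (i , j , i<j , vi≡vj) ¬repeat
      ... | tri≈ _ i≡j _ = toℕ-injective i≡j
      ... | tri> _ _ j<i = contradiction (j , i , j<i , sym vi≡vj) ¬repeat

-- Layer counts and separations

-- The number `S k` of the introduction; for `flip E?` it is `S′ k`.
layerEdges : {E : Fin n → Fin n → Set} → Decidable₂ E → ℕ → ℕ
layerEdges E? k = ∑₃ λ a x y → # (Dist? E? k a x ×-dec E? x y ×-dec Dist? E? (suc k) a y)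

-- The data of one induction step. In the order `Before`, `pivot`, `After`, the only backward edges
-- between different blocks run from `After` to `Before`, and `sparse` bounds these by nonadjacent
-- pairs across the same cut.
record Separation {E : Fin n → Fin n → Set} {P : Fin n → Set}
                  (E? : Decidable₂ E) (P? : Decidable₁ P) (c : ℕ) : Set₁ where
  field
    pivot        : Fin n
    pivot∈P      : P pivot
    Before After : Fin n → Set
    Before?      : Decidable₁ Before
    After?       : Decidable₁ After
    Before⊆P     : ∀ {u} → Before u → P u
    After⊆P      : ∀ {u} → After u → P u
    pivot∉Before : ¬ Before pivot
    pivot∉After  : ¬ After pivot
    disjoint     : ∀ {u} → Before u → ¬ After u
    cover        : ∀ {u} → P u → u ≡ pivot ⊎ Before u ⊎ After u
    pivot↛Before : ∀ {u} → Before u → ¬ E pivot u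
    After↛pivot  : ∀ {u} → After u → ¬ E u pivot
    sparse       : c * ∑₂ (λ x y → # (After? x ×-dec Before? y ×-dec E? x y)) ≤
                   ∑₂ λ x y → # (After? x ×-dec Before? y ×-dec Nonadjacent? E? x y)

-- Reversing the edges and the order together preserves which edges go backward.
Separation-flip : {E : Fin n → Fin n → Set} {P : Fin n → Set}
  {E? : Decidable₂ E} {P? : Decidable₁ P} {c : ℕ} →
  Separation (flip E?) P? c → Separation E? P? c
Separation-flip {c = c} S = record
  { pivot        = pivot
  ; pivot∈P      = pivot∈P
  ; Before       = After
  ; After        = Before
  ; Before?      = After?
  ; After?       = Before?
  ; Before⊆P     = After⊆P
  ; After⊆P      = Before⊆P
  ; pivot∉Before = pivot∉After
  ; pivot∉After  = pivot∉Before
  ; disjoint     = λ a b → disjoint b a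
  ; cover        = λ Pu → Sum.map₂ Sum.swap (cover Pu)
  ; pivot↛Before = After↛pivot
  ; After↛pivot  = pivot↛Before
  ; sparse       = ≤-trans (*-monoʳ-≤ c (transpose λ (b , a , e) → a , b , e))
                     (≤-trans sparse
                       (transpose λ (a , b , u≢w , e , e′) → b , a , u≢w ∘ sym , e , e′))
  }
  where
  open Separation S
  transpose : {R S : Fin _ → Fin _ → Set} {R? : Decidable₂ R} {S? : Decidable₂ S} →
    (∀ {u w} → R u w → S w u) → ∑₂ (λ u w → # R? u w) ≤ ∑₂ (λ u w → # S? u w)
  transpose f = ≤-trans (≤-reflexive (∑-comm _)) (∑₂-mono λ u w → #-mono f)

-- Separation by the ball around a pivot

-- Here `M` is m - 2 and the radius of the ball is `suc i`, so that radii 1, ..., m - 2 correspond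
-- to indices below `M`.
module BallSeparation
  {E : Fin n → Fin n → Set} {P : Fin n → Set} (E? : Decidable₂ E) (P? : Decidable₁ P)
  (E⊆P : ∀ {u w} → E u w → P u × P w) (P-inhabited : ∃ P)
  {M : ℕ} (no-short : NoShortClosedWalk (2 + M) E) {i : ℕ} (i<M : i < M)
  (minimal  : ∀ {t} → t < M → layerEdges E? (suc i) ≤ layerEdges E? (suc t))
  (minimal′ : ∀ {t} → t < M → layerEdges E? (suc i) ≤ layerEdges (flip E?) (suc t))
  where

  Near : Fin n → Fin n → Set
  Near b u = ∃ λ s → s < suc i × Walk E (suc s) b u

  Near? : Decidable₂ Near
  Near? b u = anyUpTo? (λ s → Walk? E? (suc s) b u) (suc i)

  Far : Fin n → Fin n → Set
  Far b u = P u × u ≢ b × ¬ Near b u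

  Far? : Decidable₂ Far
  Far? b u = P? u ×-dec ¬? (u ≟ b) ×-dec ¬? (Near? b u)

  closed : ∀ {j k u w} → Walk E (suc j) u w → Walk E k w u → j + k ≤ suc M → ⊥
  closed p q j+k≤ = no-short (s≤s j+k≤) (p ++ q)

  edge-walk : ∀ {u w} → E u w → Walk E 1 u w
  edge-walk e = _ , e , refl

  last∈P : ∀ {k u w} → Walk E (suc k) u w → P w
  last∈P {zero}  (_ , e , refl) = proj₂ (E⊆P e)
  last∈P {suc k} (_ , _ , p)    = last∈P p

  Near∌self : ∀ {b} → ¬ Near b b
  Near∌self (s , s≤i , p) = no-short (≤-trans s≤i (≤-trans i<M (ℕ.m≤n+m M 2))) p

  Near↛self : ∀ {b u} → Near b u → ¬ E u b
  Near↛self (s , s≤i , p) e = closed p (edge-walk e)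
    (≤-trans (≤-reflexive (ℕ.+-comm s 1)) (≤-trans s≤i (≤-trans i<M (ℕ.n≤1+n M))))

  -- A walk to `x` shorter than the radius would extend along the edge and put `y` into the ball. So
  -- `x` lies on the boundary and `y` one layer further.
  crossing-layers : ∀ {b x y} → Near b x → Far b y → E x y →
    Dist E (suc i) b x × E x y × Dist E (2 + i) b y
  crossing-layers {b} {x} {y} (s , s≤i , p) (_ , y≢b , ¬near-y) e =
    (subst (λ k → Walk E (suc k) b x) s≡i p , λ j<k q → y-min (s<s j<k) (snoc q e)) ,
    e ,
    (subst (λ k → Walk E (2 + k) b y) s≡i (snoc p e) , y-min)
    where
    s≡i : s ≡ i
    s≡i = ℕ.≤-antisym (s≤s⁻¹ s≤i) (≮⇒≥ λ s<i → ¬near-y (suc s , s<s s<i , snoc p e))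
    y-min : ∀ {j} → j < 2 + i → ¬ Walk E j b y
    y-min {zero}  _   b≡y = y≢b (sym b≡y)
    y-min {suc j} j<k q   = ¬near-y (j , s≤s⁻¹ j<k , q)

  -- An edge from `x` to `y` would close a walk of length 3 + k, at most 2 + M; equality or an edge
  -- from `y` to `x` would make the distance less than 2.
  far-apart : ∀ {k x y} → k < M → Dist E (2 + k) y x → Nonadjacent E x y
  far-apart {k} k<M (p , p-min) =
    (λ x≡y → p-min z<s (sym x≡y)) ,
    (λ e → closed p (edge-walk e) (s≤s (≤-trans (≤-reflexive (ℕ.+-comm k 1)) k<M))) ,
    (λ e → p-min (s<s z<s) (edge-walk e))

  -- The conjunct `P b` makes the count vanish for `b` outside `P`, so averaging over all vertices
  -- yields a pivot in `P`.
  NonadjacentAcross : Fin n → Fin n → Fin n → Set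
  NonadjacentAcross b x y = P b × Near b x × Far b y × Nonadjacent E x y

  NonadjacentAcross? : ∀ b x y → Dec (NonadjacentAcross b x y)
  NonadjacentAcross? b x y = P? b ×-dec Near? b x ×-dec Far? b y ×-dec Nonadjacent? E? x y

  -- Geodesics from `y` to `x` whose second vertex is `b`. The distance from `b` starts at 2 because
  -- distance 1 belongs to `OutOfPivot 0`.
  IntoPivot : ℕ → Fin n → Fin n → Fin n → Set
  IntoPivot t b x y = Dist E (2 + t) b x × E y b × Dist E (3 + t) y x

  IntoPivot? : ∀ t b x y → Dec (IntoPivot t b x y)
  IntoPivot? t b x y = Dist? E? (2 + t) b x ×-dec E? y b ×-dec Dist? E? (3 + t) y x

  -- Geodesics from `y` to `x` whose last vertex but one is `b`.
  OutOfPivot : ℕ → Fin n → Fin n → Fin n → Set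
  OutOfPivot t b x y = Dist E (1 + t) y b × E b x × Dist E (2 + t) y x

  OutOfPivot? : ∀ t b x y → Dec (OutOfPivot t b x y)
  OutOfPivot? t b x y = Dist? E? (1 + t) y b ×-dec E? b x ×-dec Dist? E? (2 + t) y x

  into⇒across : ∀ {t b x y} → t < i → IntoPivot t b x y → NonadjacentAcross b x y
  into⇒across {t} t<i ((p , _) , e , d) =
    proj₂ (E⊆P e) ,
    (suc t , s<s t<i , p) ,
    (proj₁ (E⊆P e) ,
     (λ { refl → no-short (s≤s z≤n) (edge-walk e) }) ,
     (λ near → Near↛self near e)) ,
    far-apart (≤-<-trans t<i i<M) d

  out⇒across : ∀ {t b x y} → t < M ∸ i → OutOfPivot t b x y → NonadjacentAcross b x y
  out⇒across {t} t<M∸i ((q@(_ , e′ , _) , q-min) , e , d) =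
    proj₁ (E⊆P e) ,
    (0 , z<s , edge-walk e) ,
    (proj₁ (E⊆P e′) ,
     q-min z<s ,
     -- A walk of length at most 1 + i from `b` to `y` and the return of length at most M - i would
     -- close a walk of length at most 1 + M; this dictates the range of `t`.
     (λ (s , s≤i , p) → closed p q
       (≤-trans (+-mono-≤ (s≤s⁻¹ s≤i) t<M∸i)
         (≤-trans (≤-reflexive (ℕ.m+[n∸m]≡n (<⇒≤ i<M))) (ℕ.n≤1+n M))))) ,
    far-apart (<-≤-trans t<M∸i (ℕ.m∸n≤m M i)) d

  -- Within each family the distance from `y` to `x` or from `b` to `x` determines `t`. The families
  -- are told apart by the edge from `b` to `x`: present for `OutOfPivot`, absent for `IntoPivot`,
  -- where `x` is at distance at least 2 from `b`.
  pivot-count : ∀ b x y →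
    ∑ {i} (λ t → # IntoPivot? (toℕ t) b x y) + ∑ {M ∸ i} (λ t → # OutOfPivot? (toℕ t) b x y) ≤
    # NonadjacentAcross? b x y
  pivot-count b x y = ≤-trans
    (+-mono-≤
      (#-unique {B? = NonadjacentAcross? b x y ×-dec ¬? (E? b x)}
        (λ t h → into⇒across (toℕ<n t) h ,
                 (λ e → proj₂ (proj₁ h) (s<s z<s) (edge-walk e)))
        (λ s t (d , _) (d′ , _) →
          toℕ-injective (ℕ.suc-injective (ℕ.suc-injective (Dist-unique d d′)))))
      (#-unique {B? = NonadjacentAcross? b x y ×-dec E? b x}
        (λ t h → out⇒across (toℕ<n t) h , proj₁ (proj₂ h))
        (λ s t (d , _) (d′ , _) → toℕ-injective (ℕ.suc-injective (Dist-unique d d′)))))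
    (#-disjoint proj₁ proj₁ λ (_ , ¬e) (_ , e) → ¬e e)

  crossing : Fin n → ℕ
  crossing b = ∑₂ λ x y → # (Near? b x ×-dec Far? b y ×-dec E? x y)

  ∑-crossing≤layerEdges : ∑ crossing ≤ layerEdges E? (suc i)
  ∑-crossing≤layerEdges = ∑₃-mono λ b x y → #-mono λ (near , far , e) → crossing-layers near far e

  -- The base point of a reversed layer becomes `x`, and its edge becomes the edge from `y` into the
  -- pivot.
  layerEdges-flip≤into : ∀ t → layerEdges (flip E?) (2 + t) ≤ ∑₃ λ b x y → # IntoPivot? t b x y
  layerEdges-flip≤into t = ≤-trans (≤-reflexive (∑₃-swap _))
    (∑₃-mono λ b x y → #-mono λ (d , e , d′) → Dist-flip d , e , Dist-flip d′)

  -- The base point becomes `y`, and the tail of the layer edge becomes the pivot.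
  layerEdges≤out : ∀ t → layerEdges E? (1 + t) ≤ ∑₃ λ b x y → # OutOfPivot? t b x y
  layerEdges≤out t = ≤-reflexive (∑₃-rotate _)

  averaged : ∑ (λ b → M * crossing b) ≤ ∑₃ λ b x y → # NonadjacentAcross? b x y
  averaged = begin
    ∑ (λ b → M * crossing b)
      ≡⟨ sym (∑-* M crossing) ⟩
    M * ∑ crossing
      ≤⟨ *-monoʳ-≤ M ∑-crossing≤layerEdges ⟩
    M * L
      ≡⟨ cong (_* L) (sym (ℕ.m+[n∸m]≡n (<⇒≤ i<M))) ⟩
    (i + (M ∸ i)) * L
      ≡⟨ ℕ.*-distribʳ-+ L i (M ∸ i) ⟩
    i * L + (M ∸ i) * L
      -- Of the `M` copies of the minimum, `i` are charged to the counts S′ 2, ..., S′ (i + 1) and M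
      -- - i to S 1, ..., S (M - i).
      ≤⟨ +-mono-≤
           (*≤∑ {i} λ t → ≤-trans (minimal′ (≤-<-trans (toℕ<n t) i<M)) (layerEdges-flip≤into (toℕ t)))
           (*≤∑ {M ∸ i} λ t → ≤-trans (minimal (<-≤-trans (toℕ<n t) (ℕ.m∸n≤m M i)))
                                       (layerEdges≤out (toℕ t))) ⟩
    ∑ {i} (λ t → ∑₃ λ b x y → # IntoPivot? (toℕ t) b x y) +
    ∑ {M ∸ i} (λ t → ∑₃ λ b x y → # OutOfPivot? (toℕ t) b x y)
      ≡⟨ cong₂ _+_ (∑-∑₃-comm _) (∑-∑₃-comm _) ⟩
    ∑₃ (λ b x y → ∑ {i} λ t → # IntoPivot? (toℕ t) b x y) +
    ∑₃ (λ b x y → ∑ {M ∸ i} λ t → # OutOfPivot? (toℕ t) b x y)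
      ≡⟨ sym (∑₃-+ _ _) ⟩
    ∑₃ (λ b x y → ∑ {i} (λ t → # IntoPivot? (toℕ t) b x y) +
                  ∑ {M ∸ i} (λ t → # OutOfPivot? (toℕ t) b x y))
      ≤⟨ ∑₃-mono pivot-count ⟩
    ∑₃ (λ b x y → # NonadjacentAcross? b x y) ∎
    where
    open ≤-Reasoning
    L : ℕ
    L = layerEdges E? (suc i)

  ballSeparation : Separation E? P? M
  ballSeparation with ∑-averaging P? P-inhabited
                        (λ b ¬Pb → ∑₂-zero λ x y → #-zero λ (Pb , _) → ¬Pb Pb) averaged
  ... | b , Pb , crossing≤across = record
    { pivot        = b
    ; pivot∈P      = Pb
    ; Before       = Far b
    ; After        = Near b
    ; Before?      = Far? b
    ; After?       = Near? b
    ; Before⊆P     = proj₁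
    ; After⊆P      = λ (_ , _ , p) → last∈P p
    ; pivot∉Before = λ (_ , b≢b , _) → b≢b refl
    ; pivot∉After  = Near∌self
    ; disjoint     = λ (_ , _ , ¬near) → ¬near
    ; cover        = cover
    ; pivot↛Before = λ (_ , _ , ¬near) e → ¬near (0 , z<s , edge-walk e)
    ; After↛pivot  = Near↛self
    ; sparse       = ≤-trans crossing≤across (∑₂-mono λ x y → #-mono proj₂)
    }
    where
    cover : ∀ {u} → P u → u ≡ b ⊎ Far b u ⊎ Near b u
    cover {u} Pu with u ≟ b | Near? b u
    ... | yes u≡b | _        = inj₁ u≡b
    ... | no _    | yes near = inj₂ (inj₂ near)
    ... | no u≢b  | no ¬near = inj₂ (inj₁ (Pu , u≢b , ¬near))

-- Choice of the radius

argmin : ∀ {k} (f : Fin (suc k) → ℕ) → ∃ λ i → ∀ j → f i ≤ f j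
argmin {zero}  f = zero , λ { zero → ≤-refl }
argmin {suc k} f with argmin (f ∘ suc)
... | i , i-min with f zero ≤? f (suc i)
... | yes f0≤fi = zero  , λ { zero → ≤-refl ; (suc j) → ≤-trans f0≤fi (i-min j) }
... | no  f0≰fi = suc i , λ { zero → <⇒≤ (≰⇒> f0≰fi) ; (suc j) → i-min j }

argmin-below : ∀ M (f : ℕ → ℕ) → ∃ λ i → i < suc M × (∀ {t} → t < suc M → f i ≤ f t)
argmin-below M f with argmin {M} (f ∘ toℕ)
... | i , i-min = toℕ i , toℕ<n i ,
  λ t<M → subst (λ t → f (toℕ i) ≤ f t) (toℕ-fromℕ< t<M) (i-min (fromℕ< t<M))

-- The smaller of the two minima is below every S and every S′. If it is an S′, the ball is taken in
-- the reversed digraph. Now m - 2 is `suc M`, so there is at least one radius to choose from.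
separation : {E : Fin n → Fin n → Set} {P : Fin n → Set} (E? : Decidable₂ E) (P? : Decidable₁ P) →
  (∀ {u w} → E u w → P u × P w) → ∃ P → ∀ {M} → NoShortClosedWalk (3 + M) E →
  Separation E? P? (suc M)
separation E? P? E⊆P P-inhabited {M} no-short
  with argmin-below M (layerEdges E? ∘ suc) | argmin-below M (layerEdges (flip E?) ∘ suc)
... | i , i<M , i-min | j , j<M , j-min
  with layerEdges E? (suc i) ≤? layerEdges (flip E?) (suc j)
... | yes i≤j = BallSeparation.ballSeparation E? P? E⊆P P-inhabited no-short i<M i-min
                  (λ t<M → ≤-trans i≤j (j-min t<M))
... | no  i≰j = Separation-flip (BallSeparation.ballSeparation (flip E?) P? (λ e → swap (E⊆P e))
                  P-inhabited (λ k<m p → no-short k<m (Walk-flip p)) j<M j-min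
                  (λ t<M → ≤-trans (<⇒≤ (≰⇒> i≰j)) (i-min t<M)))

-- Rankings with few backward edges

Induced : (Fin n → Set) → (Fin n → Fin n → Set) → Fin n → Fin n → Set
Induced P E u w = P u × P w × E u w

Induced? : {E : Fin n → Fin n → Set} {P : Fin n → Set} → Decidable₁ P → Decidable₂ E →
  Decidable₂ (Induced P E)
Induced? P? E? u w = P? u ×-dec P? w ×-dec E? u w

-- Ties count as backward, so every remaining edge strictly raises the rank.
backwardEdges : {E : Fin n → Fin n → Set} {P : Fin n → Set} → Decidable₂ E → Decidable₁ P →
  (Fin n → ℕ) → ℕ
backwardEdges E? P? r = ∑₂ λ u w → # (Induced? P? E? u w ×-dec r w ≤? r u)

-- Ordered pairs: every unordered nonadjacent pair is counted twice.
nonadjacentPairs : {E : Fin n → Fin n → Set} {P : Fin n → Set} → Decidable₂ E → Decidable₁ P → ℕ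
nonadjacentPairs E? P? = ∑₂ λ u w → # Induced? P? (Nonadjacent? E?) u w

-- The factor 2 matches the count of ordered pairs; `height` allows another ranking to be stacked on
-- top.
record Ranking {E : Fin n → Fin n → Set} {P : Fin n → Set}
               (E? : Decidable₂ E) (P? : Decidable₁ P) (c : ℕ) : Set where
  field
    rank        : Fin n → ℕ
    height      : ℕ
    rank<       : ∀ u → rank u < height
    fewBackward : 2 * (c * backwardEdges E? P? rank) ≤ nonadjacentPairs E? P?

-- Concatenating rankings along a separation

module Concatenation
  {E : Fin n → Fin n → Set} {P : Fin n → Set} {E? : Decidable₂ E} {P? : Decidable₁ P} {c : ℕ}
  (irreflexive : ∀ {u} → ¬ E u u)
  (S : Separation (Induced? P? E?) P? c)
  (B : Ranking E? (Separation.Before? S) c)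
  (A : Ranking E? (Separation.After? S) c)
  where

  open Separation S
  private
    module B = Ranking B
    module A = Ranking A

  -- `Before` lies below `B.height`, the pivot exactly there, `After` above. Vertices outside `P`
  -- share the pivot's value, which affects no counted edge.
  rank : Fin n → ℕ
  rank u with Before? u | After? u
  ... | yes _ | _     = B.rank u
  ... | no _  | yes _ = B.height + suc (A.rank u)
  ... | no _  | no _  = B.height

  rank-Before : ∀ {u} → Before u → rank u ≡ B.rank u
  rank-Before {u} b with Before? u
  ... | yes _ = refl
  ... | no ¬b = contradiction b ¬b

  rank-After : ∀ {u} → After u → rank u ≡ B.height + suc (A.rank u)
  rank-After {u} a with Before? u | After? u
  ... | yes b | _     = contradiction a (disjoint b)
  ... | no _  | yes _ = refl
  ... | no _  | no ¬a = contradiction a ¬a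

  rank-pivot : rank pivot ≡ B.height
  rank-pivot with Before? pivot | After? pivot
  ... | yes b | _     = contradiction b pivot∉Before
  ... | no _  | yes a = contradiction a pivot∉After
  ... | no _  | no _  = refl

  rank< : ∀ u → rank u < B.height + suc A.height
  rank< u with Before? u | After? u
  ... | yes _ | _     = <-≤-trans (B.rank< u) (ℕ.m≤m+n B.height _)
  ... | no _  | yes _ = ℕ.+-monoʳ-< B.height (s<s (A.rank< u))
  ... | no _  | no _  = ℕ.m<m+n B.height z<s

  Crossing? : ∀ u w → Dec (After u × Before w × Induced P E u w)
  Crossing? u w = After? u ×-dec Before? w ×-dec Induced? P? E? u w

  Across : Fin n → Fin n → Set
  Across u w = After u × Before w × Nonadjacent (Induced P E) u w

  Across? : Decidable₂ Across
  Across? u w = After? u ×-dec Before? w ×-dec Nonadjacent? (Induced? P? E?) u w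

  -- Edges from the pivot to `Before` and from `After` to the pivot do not exist, and edges from an
  -- earlier block to a later one strictly raise the rank.
  backward-cases : ∀ {u w} → Induced P E u w × rank w ≤ rank u →
    (Induced Before E u w × B.rank w ≤ B.rank u) ⊎
    (Induced After E u w × A.rank w ≤ A.rank u) ⊎
    (After u × Before w × Induced P E u w)
  backward-cases {u} {w} (e@(Pu , Pw , Euw) , w≤u) with cover Pu | cover Pw
  ... | inj₁ refl     | inj₁ refl     = contradiction Euw irreflexive
  ... | inj₁ refl     | inj₂ (inj₁ b) = contradiction e (pivot↛Before b)
  ... | inj₁ refl     | inj₂ (inj₂ a) = contradiction
    (subst₂ _≤_ (rank-After a) rank-pivot w≤u) (<⇒≱ (ℕ.m<m+n B.height z<s))
  ... | inj₂ (inj₁ b) | inj₁ refl     = contradiction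
    (subst₂ _≤_ rank-pivot (rank-Before b) w≤u) (<⇒≱ (B.rank< u))
  ... | inj₂ (inj₁ b) | inj₂ (inj₁ b′) =
    inj₁ ((b , b′ , Euw) , subst₂ _≤_ (rank-Before b′) (rank-Before b) w≤u)
  ... | inj₂ (inj₁ b) | inj₂ (inj₂ a) = contradiction
    (subst₂ _≤_ (rank-After a) (rank-Before b) w≤u)
    (<⇒≱ (<-≤-trans (B.rank< u) (ℕ.m≤m+n B.height _)))
  ... | inj₂ (inj₂ a) | inj₁ refl     = contradiction e (After↛pivot a)
  ... | inj₂ (inj₂ a) | inj₂ (inj₁ b) = inj₂ (inj₂ (a , b , e))
  ... | inj₂ (inj₂ a) | inj₂ (inj₂ a′) = inj₂ (inj₁
    ((a , a′ , Euw) ,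
     s≤s⁻¹ (ℕ.+-cancelˡ-≤ B.height _ _ (subst₂ _≤_ (rank-After a′) (rank-After a) w≤u))))

  backward≤ : backwardEdges E? P? rank ≤
    backwardEdges E? Before? B.rank + backwardEdges E? After? A.rank + ∑₂ (λ u w → # Crossing? u w)
  backward≤ = ≤-trans (∑₂-mono λ u w → #-⊎₃ backward-cases)
    (≤-reflexive (trans (∑₂-+ _ _) (cong (_+ ∑₂ (λ u w → # Crossing? u w)) (∑₂-+ _ _))))

  SameSide DifferentSides : Fin n → Fin n → Set
  SameSide u w       = (Before u × Before w) ⊎ (After u × After w)
  DifferentSides u w = (After u × Before w) ⊎ (Before u × After w)

  SameSide? : Decidable₂ SameSide
  SameSide? u w = (Before? u ×-dec Before? w) ⊎-dec (After? u ×-dec After? w)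

  DifferentSides? : Decidable₂ DifferentSides
  DifferentSides? u w = (After? u ×-dec Before? w) ⊎-dec (Before? u ×-dec After? w)

  same⇒¬different : ∀ {u w} → SameSide u w → ¬ DifferentSides u w
  same⇒¬different (inj₁ (b , _)) (inj₁ (a , _)) = disjoint b a
  same⇒¬different (inj₁ (_ , b)) (inj₂ (_ , a)) = disjoint b a
  same⇒¬different (inj₂ (_ , a)) (inj₁ (_ , b)) = disjoint b a
  same⇒¬different (inj₂ (a , _)) (inj₂ (b , _)) = disjoint b a

  across⇒nonadjacent : ∀ {u w} → Across u w → Induced P (Nonadjacent E) u w
  across⇒nonadjacent (a , b , u≢w , ¬uw , ¬wu) =
    After⊆P a , Before⊆P b , u≢w ,
    (λ e → ¬uw (After⊆P a , Before⊆P b , e)) ,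
    (λ e → ¬wu (Before⊆P b , After⊆P a , e))

  nonadjacent-swap : ∀ {u w} → Induced P (Nonadjacent E) u w → Induced P (Nonadjacent E) w u
  nonadjacent-swap (Pu , Pw , u≢w , ¬uw , ¬wu) = Pw , Pu , u≢w ∘ sym , ¬wu , ¬uw

  -- The four events are mutually exclusive. `Across` fixes which endpoint is in `After`, so it
  -- enters in both orders, matching the count of ordered pairs.
  nonadjacent-pointwise : ∀ u w →
    (# Induced? Before? (Nonadjacent? E?) u w + # Induced? After? (Nonadjacent? E?) u w) +
    (# Across? u w + # Across? w u) ≤ # Induced? P? (Nonadjacent? E?) u w
  nonadjacent-pointwise u w = ≤-trans
    (+-mono-≤
      (#-disjoint {C? = Induced? P? (Nonadjacent? E?) u w ×-dec SameSide? u w}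
        (λ (b , b′ , na) → (Before⊆P b , Before⊆P b′ , na) , inj₁ (b , b′))
        (λ (a , a′ , na) → (After⊆P a , After⊆P a′ , na) , inj₂ (a , a′))
        (λ (b , _) (a , _) → disjoint b a))
      (#-disjoint {C? = Induced? P? (Nonadjacent? E?) u w ×-dec DifferentSides? u w}
        (λ h → across⇒nonadjacent h , inj₁ (proj₁ h , proj₁ (proj₂ h)))
        (λ h → nonadjacent-swap (across⇒nonadjacent h) , inj₂ (proj₁ (proj₂ h) , proj₁ h))
        (λ (a , _) (_ , b , _) → disjoint b a)))
    (#-disjoint proj₁ proj₁ λ (_ , same) (_ , different) → same⇒¬different same different)

  nonadjacent≥ :
    (nonadjacentPairs E? Before? + nonadjacentPairs E? After?) +
    (∑₂ (λ u w → # Across? u w) + ∑₂ (λ u w → # Across? u w)) ≤ nonadjacentPairs E? P?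
  nonadjacent≥ = begin
    (nonadjacentPairs E? Before? + nonadjacentPairs E? After?) +
    (∑₂ (λ u w → # Across? u w) + ∑₂ (λ u w → # Across? u w))
      ≡⟨ cong₂ _+_ (sym (∑₂-+ _ _))
           (trans (cong (∑₂ (λ u w → # Across? u w) +_) (∑-comm _)) (sym (∑₂-+ _ _))) ⟩
    ∑₂ (λ u w → # Induced? Before? (Nonadjacent? E?) u w + # Induced? After? (Nonadjacent? E?) u w) +
    ∑₂ (λ u w → # Across? u w + # Across? w u)
      ≡⟨ sym (∑₂-+ _ _) ⟩
    ∑₂ (λ u w →
      (# Induced? Before? (Nonadjacent? E?) u w + # Induced? After? (Nonadjacent? E?) u w) +
      (# Across? u w + # Across? w u))
      ≤⟨ ∑₂-mono nonadjacent-pointwise ⟩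
    nonadjacentPairs E? P? ∎
    where open ≤-Reasoning

  double-distrib : ∀ c b a x → 2 * (c * (b + a + x)) ≡ (2 * (c * b) + 2 * (c * a)) + (c * x + c * x)
  double-distrib = solve-∀

  ranking : Ranking E? P? c
  ranking = record
    { rank        = rank
    ; height      = B.height + suc A.height
    ; rank<       = rank<
    ; fewBackward = begin
        2 * (c * backwardEdges E? P? rank)
          ≤⟨ *-monoʳ-≤ 2 (*-monoʳ-≤ c backward≤) ⟩
        2 * (c * (backwardEdges E? Before? B.rank + backwardEdges E? After? A.rank +
                  ∑₂ (λ u w → # Crossing? u w)))
          ≡⟨ double-distrib c _ _ _ ⟩
        (2 * (c * backwardEdges E? Before? B.rank) + 2 * (c * backwardEdges E? After? A.rank)) +
        (c * ∑₂ (λ u w → # Crossing? u w) + c * ∑₂ (λ u w → # Crossing? u w))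
          ≤⟨ +-mono-≤ (+-mono-≤ B.fewBackward A.fewBackward) (+-mono-≤ sparse sparse) ⟩
        (nonadjacentPairs E? Before? + nonadjacentPairs E? After?) +
        (∑₂ (λ u w → # Across? u w) + ∑₂ (λ u w → # Across? u w))
          ≤⟨ nonadjacent≥ ⟩
        nonadjacentPairs E? P? ∎
    }
    where open ≤-Reasoning

-- Induction on the vertex set

-- The pivot lies in `P` but on neither side of the separation, so both sides have fewer vertices
-- than `P`.
ranking : {E : Fin n → Fin n → Set} (E? : Decidable₂ E) {M : ℕ} → NoShortClosedWalk (3 + M) E →
  {P : Fin n → Set} (P? : Decidable₁ P) → Acc _<_ (∑ λ u → # P? u) → Ranking E? P? (suc M)
ranking E? {M} no-short P? (acc smaller) with any? P?
... | no P-empty = record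
  { rank        = λ _ → 0
  ; height      = 1
  ; rank<       = λ _ → z<s
  ; fewBackward = subst (_≤ nonadjacentPairs E? P?)
      (sym (trans (cong (λ k → 2 * (suc M * k)) no-edges) (cong (2 *_) (ℕ.*-zeroʳ (suc M))))) z≤n
  }
  where
  no-edges : backwardEdges E? P? (λ _ → 0) ≡ 0
  no-edges = ∑₂-zero λ u w → #-zero λ ((Pu , _) , _) → P-empty (u , Pu)
... | yes P-inhabited = Concatenation.ranking (λ e → no-short (s≤s z≤n) (_ , e , refl)) S
    (ranking E? no-short Before? (smaller (∑-mono-< (λ u → #-mono Before⊆P) pivot (#-< pivot∉Before pivot∈P))))
    (ranking E? no-short After? (smaller (∑-mono-< (λ u → #-mono After⊆P) pivot (#-< pivot∉After pivot∈P))))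
  where
  S : Separation (Induced? P? E?) P? (suc M)
  S = separation (Induced? P? E?) P? (λ (Pu , Pw , _) → Pu , Pw) P-inhabited
        (λ k<m p → no-short k<m (Walk-map (λ (_ , _ , e) → e) p))
  open Separation S

-- From rankings to feedback edge sets

-- Along a cycle the rank of the last vertex is at least that of the first, yet the closing edge
-- would raise it again.
increasing⇒acyclic : (E : Fin n → Fin n → Bool) (r : Fin n → ℕ) →
  (∀ {u w} → T (E u w) → r u < r w) → Acyclic E
increasing⇒acyclic E r increasing k C =
  n≮n _ (≤-<-trans (first≤last k (r ∘ vert) (λ i → <⇒≤ (increasing (step i)))) (increasing close))
  where
  open DirCycle C
  first≤last : ∀ k (f : Fin (suc k) → ℕ) → (∀ i → f (inject₁ i) ≤ f (suc i)) → f zero ≤ f (fromℕ k)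
  first≤last zero    f f≤ = ≤-refl
  first≤last (suc k) f f≤ = ≤-trans (f≤ zero) (first≤last k (f ∘ suc) (f≤ ∘ suc))

T-not : ∀ {b} → T (not b) → ¬ T b
T-not {false} _ ()

¬T⇒T-not : ∀ {b} → ¬ T b → T (not b)
¬T⇒T-not {false} _  = tt
¬T⇒T-not {true}  ¬t = ¬t tt

-- Comparing indices orients each nonadjacent pair; each of the two orientations contributes one
-- copy of `γ G`.
nonadjacentPairs≤2γ : (G : Digraph n) {P : Fin n → Set} (P? : Decidable₁ P) →
  nonadjacentPairs (λ u w → T? (edge G u w)) P? ≤ 2 * γ G
nonadjacentPairs≤2γ G P? = begin
  nonadjacentPairs (λ u w → T? (edge G u w)) P?
    ≤⟨ ∑₂-mono (λ u w → #-⊎ (oriented u w)) ⟩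
  ∑₂ (λ u w → # T? (pair u w) + # T? (pair w u))
    ≡⟨ ∑₂-+ _ _ ⟩
  ∑₂ (λ u w → # T? (pair u w)) + ∑₂ (λ u w → # T? (pair w u))
    ≡⟨ cong (∑₂ (λ u w → # T? (pair u w)) +_) (∑-comm _) ⟩
  ∑₂ (λ u w → # T? (pair u w)) + ∑₂ (λ u w → # T? (pair u w))
    ≡⟨ cong₂ _+_ (size≡∑₂ pair) (trans (ℕ.+-identityʳ (γ G)) (size≡∑₂ pair)) ⟨
  2 * γ G ∎
  where
  open ≤-Reasoning
  pair : Fin _ → Fin _ → Bool
  pair u w = isYes (toℕ u <? toℕ w) ∧ nonadj G u w
  pair-T : ∀ {u w} → toℕ u < toℕ w → ¬ T (edge G u w) → ¬ T (edge G w u) → T (pair u w)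
  pair-T {u} {w} u<w ¬uw ¬wu = Equivalence.from (T-∧ {isYes (toℕ u <? toℕ w)})
    (fromWitness u<w , Equivalence.from (T-∧ {not (edge G u w)}) (¬T⇒T-not ¬uw , ¬T⇒T-not ¬wu))
  oriented : ∀ u w → Induced _ (Nonadjacent (λ u w → T (edge G u w))) u w → T (pair u w) ⊎ T (pair w u)
  oriented u w (_ , _ , u≢w , ¬uw , ¬wu) with <-cmp (toℕ u) (toℕ w)
  ... | tri< u<w _ _ = inj₁ (pair-T u<w ¬uw ¬wu)
  ... | tri≈ _ u≡w _ = contradiction (toℕ-injective u≡w) u≢w
  ... | tri> _ _ w<u = inj₂ (pair-T w<u ¬wu ¬uw)

theorem1p4 : (m : ℕ) → 4 ≤ m → (n : ℕ) → (G : Digraph n) → MFree m G →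
    Σ (Fin n → Fin n → Bool) λ X → IsFeedbackSet G X × ((m ∸ 2) * size X ≤ γ G)
-- Matching `m` as 3 + M makes `m ∸ 2` reduce to `suc M`.
theorem1p4 (suc (suc (suc M))) (s≤s (s≤s (s≤s _))) n G m-free =
  X , (X⊆E , increasing⇒acyclic _ rank increasing) , ℕ.*-cancelˡ-≤ 2 few
  where
  E? : Decidable₂ λ u w → T (edge G u w)
  E? u w = T? (edge G u w)
  all? : Decidable₁ {A = Fin n} λ _ → ⊤
  all? _ = yes tt
  open Ranking (ranking E? {M} (MFree⇒NoShortClosedWalk G m-free) all? (<-wellFounded _))
  X : Fin n → Fin n → Bool
  -- The feedback set consists of the backward edges of the ranking of all vertices.
  X u w = edge G u w ∧ isYes (rank w ≤? rank u)
  X-T : ∀ {u w} → T (X u w) → T (edge G u w) × rank w ≤ rank u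
  X-T {u} {w} x with Equivalence.to (T-∧ {edge G u w}) x
  ... | e , w≤u = e , toWitness w≤u
  X⊆E : ∀ u w → T (X u w) → T (edge G u w)
  X⊆E u w x = proj₁ (X-T x)
  increasing : ∀ {u w} → T (removeEdges (edge G) X u w) → rank u < rank w
  increasing {u} {w} x with Equivalence.to (T-∧ {edge G u w}) x
  ... | e , ¬Xuw = ≰⇒> λ w≤u → T-not ¬Xuw (Equivalence.from (T-∧ {edge G u w}) (e , fromWitness w≤u))
  size-X≤ : size X ≤ backwardEdges E? all? rank
  size-X≤ = ≤-trans (≤-reflexive (size≡∑₂ X)) (∑₂-mono λ u w → #-mono λ x →
    (tt , tt , proj₁ (X-T x)) , proj₂ (X-T x))
  few : 2 * (suc M * size X) ≤ 2 * γ G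
  few = ≤-trans (*-monoʳ-≤ 2 (*-monoʳ-≤ (suc M) size-X≤))
    (≤-trans fewBackward (nonadjacentPairs≤2γ G all?))
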